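{- Let $C$ be a finite set of level constraints in normal form with $\mathcal{I}(C) \cap \mathcal{I}_{fresh} = \emptyset$. If $C; id \leadsto^* \bot$ by a finite sequence of unification steps, then there is no level substitution $\theta$ with $\theta \vDash C$.
   Context: Levels: $l ::= i \mid \mathtt{z} \mid \mathtt{s}\,l \mid l \sqcup l'$, $i$ in an infinite totally ordered set $\mathcal{I}$ of level variables; $\simeq$ is the smallest congruence (closed under constructors and substitution of levels for variables) containing $i_1 \sqcup (i_2 \sqcup i_3) \approx (i_1 \sqcup i_2) \sqcup i_3$, $i_1 \sqcup i_2 \approx i_2 \sqcup i_1$, $\mathtt{s}(i_1 \sqcup i_2) \approx \mathtt{s}\,i_1 \sqcup \mathtt{s}\,i_2$, $i \sqcup \mathtt{s}\,i \approx \mathtt{s}\,i$, $i \sqcup \mathtt{z} \approx i$, $i \sqcup i \approx i$. Normal form of levels: $\mathtt{s}^k\,\mathtt{z} \sqcup (\sqcup_{i \in V} \mathtt{s}^{n_i}\,i)$ with $V$ a strictly increasing sequence of variables, $n_i \le k$; every $l$ has a unique normal form $\hat l \simeq l$. A constraint $l_1 = l_2$ is in normal form if both sides are in normal form, each variable occurring on both sides has the same exponent on both sides, and at least one exponent (of $\mathtt{z}$ or of a variable, on either side) is $0$; $\widehat{C}$ denotes putting each constraint of $C$ in normal form (normalize both sides, for a variable on both sides drop the occurrence with smaller exponent, then subtract the minimum exponent from all exponents). $\theta \vDash C$ means $l_1\theta \simeq l_2\theta$ for all $l_1 = l_2 \in C$. $id$ is the identity substitution. For substitutions: $dom\,\theta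 = \{i \mid i\theta \ne i\}$; $\mathcal{I}(l)$ is the set of variables of $l$; $range\,\theta = \bigcup_{i \in dom\,\theta} \mathcal{I}(i\theta)$; $\mathcal{I}(\theta) = dom\,\theta \cup range\,\theta$; $\widehat{\theta} = \{i \mapsto \widehat{i\theta}\}_{i \in dom\,\theta}$; $\theta\{l/j\} = \{i \mapsto (i\theta)\{l/j\}\}_{i \in dom\,\theta}$; $\mathcal{I}_{fresh} \subsetneq \mathcal{I}$ is a fixed infinite set of fresh variables. In normal-form levels, $\mathtt{z} \sqcup i$ means $\mathtt{s}^0\mathtt{z} \sqcup \mathtt{s}^0 i$, and "$\mathtt{s}^m\,x \in l$" means $\mathtt{s}^m\,x$ is a summand of $l$. The unification steps on pairs $C;\theta$ are: (Trivial) $\{l = l\} \cup C; \theta \leadsto C; \theta$. (Orient) $\{l = l'\} \cup C; \theta \leadsto \{l' = l\} \cup C; \theta$ if $l'$ is $\mathtt{z}$ or $\mathtt{z} \sqcup i$. (Eliminate 1) $\{\mathtt{z} \sqcup i = l\} \cup C; \theta \leadsto \widehat{C\{l/i\}}; (\widehat{\theta\{l/i\}}, i \mapsto l)$ if $i$ does not occur in $l$. (Eliminate 2) $\{\mathtt{z} \sqcup i = l\} \cup C; \theta \leadsto \widehat{C\{l'/i\}}; (\widehat{\theta\{l'/i\}}, i \mapsto l')$ where $l' = l\{i'/i\}$ for some $i' \in \mathcal{I}_{fresh} \setminus \mathcal{I}(i, l, C, \theta)$, if $\mathtt{s}^0\,i \in l$. (Decompose) $\{\mathtt{z} = \mathtt{z}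 \sqcup (\sqcup_{i \in V} i)\} \cup C; \theta \leadsto \{\mathtt{z} \sqcup i = \mathtt{z}\}_{i \in V} \cup C; \theta$. (Clash) $\{\mathtt{z} = l\} \cup C; \theta \leadsto \bot$ if $\mathtt{s}^n\,i \in l$ or $\mathtt{s}^n\,\mathtt{z} \in l$ for some $n \ne 0$. -}

module Defs where

import Level as Agda
open import Data.Bool.Base using (if_then_else_)
open import Data.List.Base using (List; []; _∷_; _++_; map; foldr; filter; concatMap)
open import Data.List.Membership.Propositional using (_∈_; _∉_)
open import Data.List.Relation.Binary.BagAndSetEquality using (_∼[_]_; set)
open import Data.List.Relation.Unary.All as All using (All; []; _∷_)
open import Data.List.Relation.Unary.All.Properties using (map⁺; map⁻)
open import Data.List.Relation.Unary.AllPairs using (AllPairs; []; _∷_)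
open import Data.List.Relation.Unary.Any using (here; there; any?)
open import Data.List.Relation.Unary.Linked using (Linked)
open import Data.List.Relation.Unary.Linked.Properties using (AllPairs⇒Linked)
open import Data.Nat.Base as ℕ using (ℕ; zero; suc; _∸_; _⊓_; _≤_)
import Data.Nat.Properties as ℕ
open import Data.Product.Base using (_×_; _,_; ∃; ∃₂; proj₁; proj₂)
open import Data.Sum.Base using (_⊎_)
open import Relation.Binary.Bundles using (Setoid)
open import Relation.Binary.Construct.Closure.ReflexiveTransitive using (Star)
open import Relation.Binary.Core using (Rel)
open import Relation.Binary.Definitions using (tri<; tri≈; tri>)
open import Relation.Binary.PropositionalEquality using (_≡_; _≢_; refl; cong; cong₂; subst₂)
import Relation.Binary.Reasoning.Setoid as SetoidReasoning
open import Relation.Binary.Structures using (IsStrictTotalOrder)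
open import Relation.Nullary.Decidable using (Dec; yes; no; does; map′; _×-dec_; ¬?; dec-true; dec-false)
open import Relation.Nullary.Negation using (¬_)
open import Relation.Unary using (Pred)

-- "Infinite" is expressed constructively: every finite list misses some
-- element.  Infinitude of Var itself follows from that of Fresh.
record LevelVariables a ℓ p : Set (Agda.suc (a Agda.⊔ ℓ Agda.⊔ p)) where
  field
    Var                : Set a
    _<_                : Rel Var ℓ
    isStrictTotalOrder : IsStrictTotalOrder _≡_ _<_
    Fresh              : Pred Var p
    fresh-infinite     : ∀ (is : List Var) → ∃ λ i → Fresh i × i ∉ is
    fresh-proper       : ∃ λ i → ¬ Fresh i

module Unification {a ℓ p} (𝓘 : LevelVariables a ℓ p) where

  open LevelVariables 𝓘 public
  open IsStrictTotalOrder isStrictTotalOrder using (_≟_; compare) renaming (trans to <-trans)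

  infixl 6 _⊔_
  infix  7 s^_
  infix  8 _[_]
  infix  4 _≈_ _≃_ _∋_ _≐_ _⊨_
  infix  4 _∥_
  infixl 5 _,_↦_
  infix  3 _⇝_ _⇝*_

  data Level : Set a where
    var : Var → Level
    z   : Level
    s   : Level → Level
    _⊔_ : Level → Level → Level

  s^_ : ℕ → Level → Level
  (s^ zero)  l = l
  (s^ suc n) l = s ((s^ n) l)

  vars : Level → List Var
  vars (var i) = i ∷ []
  vars z       = []
  vars (s l)   = vars l
  vars (l ⊔ m) = vars l ++ vars m

  Subst : Set a
  Subst = Var → Level

  id : Subst
  id = var

  _[_] : Level → Subst → Level
  var i   [ θ ] = θ i
  z       [ θ ] = z
  s l     [ θ ] = s (l [ θ ])
  (l ⊔ m) [ θ ] = l [ θ ] ⊔ m [ θ ]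

  _,_↦_ : Subst → Var → Level → Subst
  (θ , i ↦ l) j = if does (j ≟ i) then l else θ j

  _/_ : Level → Var → Subst
  l / i = id , i ↦ l

  data _≈_ : Rel Level a where
    assoc  : ∀ i j k → var i ⊔ (var j ⊔ var k) ≈ (var i ⊔ var j) ⊔ var k
    comm   : ∀ i j   → var i ⊔ var j ≈ var j ⊔ var i
    s-⊔    : ∀ i j   → s (var i ⊔ var j) ≈ s (var i) ⊔ s (var j)
    absorb : ∀ i     → var i ⊔ s (var i) ≈ s (var i)
    unit   : ∀ i     → var i ⊔ z ≈ var i
    idem   : ∀ i     → var i ⊔ var i ≈ var i

  data _≃_ : Rel Level a where
    axiom   : ∀ {l m} → l ≈ m → l ≃ m
    ≃-refl  : ∀ {l} → l ≃ l
    ≃-sym   : ∀ {l m} → l ≃ m → m ≃ l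
    ≃-trans : ∀ {l m n} → l ≃ m → m ≃ n → l ≃ n
    s-cong  : ∀ {l m} → l ≃ m → s l ≃ s m
    ⊔-cong  : ∀ {l l′ m m′} → l ≃ l′ → m ≃ m′ → l ⊔ m ≃ l′ ⊔ m′
    []-cong : ∀ {l m} (θ : Subst) → l ≃ m → l [ θ ] ≃ m [ θ ]

  -- l ∋ t: t is one of the summands of l.  Used with t of the form
  -- (s^ n) z or (s^ n) (var i).
  data _∋_ : Level → Level → Set a where
    here  : ∀ {t} → t ∋ t
    left  : ∀ {l m t} → l ∋ t → l ⊔ m ∋ t
    right : ∀ {l m t} → m ∋ t → l ⊔ m ∋ t

  -- A pair (i , n) stands for the summand sⁿ i.
  Summands : Set a
  Summands = List (Var × ℕ)

  ⨆⁺ : Var × ℕ → Summands → Level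
  ⨆⁺ (i , n) []       = (s^ n) (var i)
  ⨆⁺ (i , n) (u ∷ us) = (s^ n) (var i) ⊔ ⨆⁺ u us

  -- nf k us is sᵏ z ⊔ (⨆ us), where an empty join is omitted.
  nf : ℕ → Summands → Level
  nf k []       = (s^ k) z
  nf k (u ∷ us) = (s^ k) z ⊔ ⨆⁺ u us

  Increasing : Pred (List Var) (a Agda.⊔ ℓ)
  Increasing = Linked _<_

  IsNormal : Pred Level (a Agda.⊔ ℓ)
  IsNormal l = ∃₂ λ k us →
    Increasing (map proj₁ us) × All (λ u → proj₂ u ≤ k) us × l ≡ nf k us

  sucAll : Summands → Summands
  sucAll = map λ (i , n) → i , suc n

  insert : Var × ℕ → Summands → Summands
  insert u       []             = u ∷ []
  insert (i , n) ((j , m) ∷ us) with compare i j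
  ... | tri< _ _ _ = (i , n) ∷ (j , m) ∷ us
  ... | tri≈ _ _ _ = (i , n ℕ.⊔ m) ∷ us
  ... | tri> _ _ _ = (j , m) ∷ insert (i , n) us

  normalise : Level → ℕ × Summands
  normalise (var i) = 0 , (i , 0) ∷ []
  normalise z       = 0 , []
  normalise (s l)   = let (k , us) = normalise l in suc k , sucAll us
  normalise (l ⊔ m) =
    let (k₁ , us₁) = normalise l
        (k₂ , us₂) = normalise m
    in k₁ ℕ.⊔ k₂ , foldr insert us₂ us₁

  -- The normal form of l; see ^-normal and ^-≃ at the end of the module.
  _^ : Level → Level
  l ^ = let (k , us) = normalise l in nf k us

  record Constraint : Set a where
    constructor _≐_
    field lhs rhs : Level

  varsᶜ : Constraint → List Var
  varsᶜ (l ≐ m) = vars l ++ vars m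

  varsᶜˢ : List Constraint → List Var
  varsᶜˢ = concatMap varsᶜ

  HasZeroExponent : Pred Level a
  HasZeroExponent l = l ∋ (s^ 0) z ⊎ ∃ λ i → l ∋ (s^ 0) (var i)

  IsNormalᶜ : Pred Constraint (a Agda.⊔ ℓ)
  IsNormalᶜ (l₁ ≐ l₂) =
      IsNormal l₁
    × IsNormal l₂
    × (∀ i n₁ n₂ → l₁ ∋ (s^ n₁) (var i) → l₂ ∋ (s^ n₂) (var i) → n₁ ≡ n₂)
    × (HasZeroExponent l₁ ⊎ HasZeroExponent l₂)

  dropSmaller : (us others : Summands) → Summands
  dropSmaller us others = filter (λ (i , m) →
    ¬? (any? (λ (j , n) → (i ≟ j) ×-dec (m ℕ.<? n)) others)) us

  _^ᶜ : Constraint → Constraint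
  (l₁ ≐ l₂) ^ᶜ =
    let (k₁ , us₁) = normalise l₁
        (k₂ , us₂) = normalise l₂
        vs₁        = dropSmaller us₁ us₂
        vs₂        = dropSmaller us₂ us₁
        least      = foldr _⊓_ (k₁ ⊓ k₂) (map proj₂ (vs₁ ++ vs₂))
        lower      = map λ (i , n) → i , n ∸ least
    in nf (k₁ ∸ least) (lower vs₁) ≐ nf (k₂ ∸ least) (lower vs₂)

  _[_]ᶜ : Constraint → Subst → Constraint
  (l ≐ m) [ θ ]ᶜ = l [ θ ] ≐ m [ θ ]

  -- Finite sets of constraints are lists, compared by _∼[ set ]_.
  _[_]^ᶜˢ : List Constraint → Subst → List Constraint
  C [ θ ]^ᶜˢ = map (λ c → (c [ θ ]ᶜ) ^ᶜ) C

  _⊨_ : Subst → List Constraint → Set a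
  θ ⊨ C = All (λ (l ≐ m) → l [ θ ] ≃ m [ θ ]) C

  Dom : Subst → Pred Var a
  Dom θ i = θ i ≢ var i

  Range : Subst → Pred Var a
  Range θ j = ∃ λ i → Dom θ i × j ∈ vars (θ i)

  Varsˢ : Subst → Pred Var a
  Varsˢ θ i = Dom θ i ⊎ Range θ i

  _≟ᵛ_ : ∀ l i → Dec (l ≡ var i)
  var j   ≟ᵛ i = map′ (cong var) (λ { refl → refl }) (j ≟ i)
  z       ≟ᵛ i = no λ ()
  s l     ≟ᵛ i = no λ ()
  (l ⊔ m) ≟ᵛ i = no λ ()

  -- { i ↦ f (θ i) } for i ∈ Dom θ.  Variables outside the domain stay
  -- untouched, in particular they are not replaced by z ⊔ i.
  onDom : (Level → Level) → Subst → Subst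
  onDom f θ i = if does (θ i ≟ᵛ i) then var i else f (θ i)

  _^ˢ : Subst → Subst
  θ ^ˢ = onDom _^ θ

  _[_]ˢ : Subst → Subst → Subst
  θ [ σ ]ˢ = onDom (_[ σ ]) θ

  data State : Set a where
    _∥_ : List Constraint → Subst → State
    ⊥   : State

  -- The state on the left is always D ∥ θ, where D represents the set
  -- displayed after D ∼[ set ].
  data _⇝_ : State → State → Set (a Agda.⊔ ℓ Agda.⊔ p) where

    trivial : ∀ {D C θ} l →
      D ∼[ set ] (l ≐ l) ∷ C →
      D ∥ θ ⇝ C ∥ θ

    orient : ∀ {D C θ} l l′ →
      D ∼[ set ] (l ≐ l′) ∷ C →
      (l′ ≡ z ⊎ ∃ λ i → l′ ≡ z ⊔ var i) →
      D ∥ θ ⇝ (l′ ≐ l) ∷ C ∥ θ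

    eliminate₁ : ∀ {D C θ} i l →
      D ∼[ set ] (z ⊔ var i ≐ l) ∷ C →
      i ∉ vars l →
      D ∥ θ ⇝ C [ l / i ]^ᶜˢ ∥ ((θ [ l / i ]ˢ) ^ˢ , i ↦ l)

    eliminate₂ : ∀ {D C θ} i l i′ →
      D ∼[ set ] (z ⊔ var i ≐ l) ∷ C →
      l ∋ (s^ 0) (var i) →
      Fresh i′ → i′ ≢ i → i′ ∉ vars l → i′ ∉ varsᶜˢ C → ¬ Varsˢ θ i′ →
      let l′ = l [ var i′ / i ] in
      D ∥ θ ⇝ C [ l′ / i ]^ᶜˢ ∥ ((θ [ l′ / i ]ˢ) ^ˢ , i ↦ l′)

    decompose : ∀ {D C θ} V →
      Increasing V →
      D ∼[ set ] (z ≐ nf 0 (map (_, 0) V)) ∷ C →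
      D ∥ θ ⇝ map (λ i → z ⊔ var i ≐ z) V ++ C ∥ θ

    clash : ∀ {D C θ} l n →
      D ∼[ set ] (z ≐ l) ∷ C →
      n ≢ 0 →
      ((∃ λ i → l ∋ (s^ n) (var i)) ⊎ l ∋ (s^ n) z) →
      D ∥ θ ⇝ ⊥

  _⇝*_ : State → State → Set (a Agda.⊔ ℓ Agda.⊔ p)
  _⇝*_ = Star _⇝_

  -- Correctness of l ^: it is a normal form, and it is equivalent to l.

  private

    ordered-insert : ∀ u us → AllPairs _<_ (map proj₁ us) →
                     AllPairs _<_ (map proj₁ (insert u us))
    All-insert : ∀ {q} {P : Pred (Var × ℕ) q} {i n} us →
                 (∀ m → (i , m) ∈ us → P (i , n ℕ.⊔ m)) →
                 P (i , n) → All P us → All P (insert (i , n) us)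

    All-insert []             f p []       = p ∷ []
    All-insert {i = i} ((j , m) ∷ us) f p (q ∷ qs) with compare i j
    ... | tri< _ _ _    = p ∷ q ∷ qs
    ... | tri≈ _ refl _ = f m (here refl) ∷ qs
    ... | tri> _ _ _    = q ∷ All-insert us (λ m i∈ → f m (there i∈)) p qs

    ordered-insert u       []             []       = [] ∷ []
    ordered-insert (i , n) ((j , m) ∷ us) (p ∷ ps) with compare i j
    ... | tri< i<j _ _  = (i<j ∷ All.map (<-trans i<j) p) ∷ p ∷ ps
    ... | tri≈ _ refl _ = p ∷ ps
    ... | tri> _ _ j<i  =
      map⁺ (All-insert us (λ _ _ → j<i) j<i (map⁻ p)) ∷ ordered-insert (i , n) us ps

    ordered-merge : ∀ us vs → AllPairs _<_ (map proj₁ vs) →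
                    AllPairs _<_ (map proj₁ (foldr insert vs us))
    ordered-merge []       vs p = p
    ordered-merge (u ∷ us) vs p = ordered-insert u _ (ordered-merge us vs p)

    Bounded : ℕ → Summands → Set a
    Bounded k = All (λ u → proj₂ u ≤ k)

    bounded-insert : ∀ {k i n} us → n ≤ k → Bounded k us → Bounded k (insert (i , n) us)
    bounded-insert us n≤k b =
      All-insert us (λ _ i∈ → ℕ.⊔-lub n≤k (All.lookup b i∈)) n≤k b

    bounded-merge : ∀ {k} us vs → Bounded k us → Bounded k vs → Bounded k (foldr insert vs us)
    bounded-merge []       vs []      b = b
    bounded-merge (u ∷ us) vs (c ∷ cs) b = bounded-insert _ c (bounded-merge us vs cs b)

    ordered-sucAll : ∀ us → AllPairs _<_ (map proj₁ us) → AllPairs _<_ (map proj₁ (sucAll us))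
    ordered-sucAll []       []       = []
    ordered-sucAll (u ∷ us) (p ∷ ps) =
      map⁺ (map⁺ (map⁻ p)) ∷ ordered-sucAll us ps

    normalise-ordered : ∀ l → AllPairs _<_ (map proj₁ (proj₂ (normalise l)))
    normalise-ordered (var i) = [] ∷ []
    normalise-ordered z       = []
    normalise-ordered (s l)   = ordered-sucAll _ (normalise-ordered l)
    normalise-ordered (l ⊔ m) = ordered-merge (proj₂ (normalise l)) _ (normalise-ordered m)

    normalise-bounded : ∀ l → Bounded (proj₁ (normalise l)) (proj₂ (normalise l))
    normalise-bounded (var i) = ℕ.z≤n ∷ []
    normalise-bounded z       = []
    normalise-bounded (s l)   = map⁺ (All.map ℕ.s≤s (normalise-bounded l))
    normalise-bounded (l ⊔ m) = bounded-merge (proj₂ (normalise l)) _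
      (All.map (λ b → ℕ.m≤n⇒m≤n⊔o _ b) (normalise-bounded l))
      (All.map (λ b → ℕ.m≤n⇒m≤o⊔n _ b) (normalise-bounded m))

  ^-normal : ∀ l → IsNormal (l ^)
  ^-normal l = _ , _ , AllPairs⇒Linked (normalise-ordered l) , normalise-bounded l , refl

  private

    ≃-setoid : Setoid a a
    ≃-setoid = record
      { _≈_ = _≃_
      ; isEquivalence = record { refl = ≃-refl ; sym = ≃-sym ; trans = ≃-trans }
      }

    open SetoidReasoning ≃-setoid

    ↦-hit : ∀ θ i l → (θ , i ↦ l) i ≡ l
    ↦-hit θ i l rewrite dec-true (i ≟ i) refl = refl

    ↦-miss : ∀ θ i l j → j ≢ i → (θ , i ↦ l) j ≡ θ j
    ↦-miss θ i l j j≢i rewrite dec-false (j ≟ i) j≢i = refl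

    i₁ i₂ i₃ : Var
    i₁ = proj₁ (fresh-infinite [])
    i₂ = proj₁ (fresh-infinite (i₁ ∷ []))
    i₃ = proj₁ (fresh-infinite (i₁ ∷ i₂ ∷ []))

    i₂≢i₁ : i₂ ≢ i₁
    i₂≢i₁ e = proj₂ (proj₂ (fresh-infinite (i₁ ∷ []))) (here e)

    i₃≢i₁ : i₃ ≢ i₁
    i₃≢i₁ e = proj₂ (proj₂ (fresh-infinite (i₁ ∷ i₂ ∷ []))) (here e)

    i₃≢i₂ : i₃ ≢ i₂
    i₃≢i₂ e = proj₂ (proj₂ (fresh-infinite (i₁ ∷ i₂ ∷ []))) (there (here e))

    module Instance (l₁ l₂ l₃ : Level) where

      σ : Subst
      σ = ((id , i₃ ↦ l₃) , i₂ ↦ l₂) , i₁ ↦ l₁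

      σ₁ : σ i₁ ≡ l₁
      σ₁ = ↦-hit ((id , i₃ ↦ l₃) , i₂ ↦ l₂) i₁ l₁

      σ₂ : σ i₂ ≡ l₂
      σ₂ rewrite ↦-miss ((id , i₃ ↦ l₃) , i₂ ↦ l₂) i₁ l₁ i₂ i₂≢i₁ = ↦-hit (id , i₃ ↦ l₃) i₂ l₂

      σ₃ : σ i₃ ≡ l₃
      σ₃ rewrite ↦-miss ((id , i₃ ↦ l₃) , i₂ ↦ l₂) i₁ l₁ i₃ i₃≢i₁
               | ↦-miss (id , i₃ ↦ l₃) i₂ l₂ i₃ i₃≢i₂ = ↦-hit id i₃ l₃

    ⊔-assoc : ∀ l m n → l ⊔ (m ⊔ n) ≃ (l ⊔ m) ⊔ n
    ⊔-assoc l m n = subst₂ _≃_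
      (cong₂ _⊔_ σ₁ (cong₂ _⊔_ σ₂ σ₃)) (cong₂ _⊔_ (cong₂ _⊔_ σ₁ σ₂) σ₃)
      ([]-cong σ (axiom (assoc i₁ i₂ i₃)))
      where open Instance l m n

    ⊔-comm : ∀ l m → l ⊔ m ≃ m ⊔ l
    ⊔-comm l m = subst₂ _≃_ (cong₂ _⊔_ σ₁ σ₂) (cong₂ _⊔_ σ₂ σ₁)
      ([]-cong σ (axiom (comm i₁ i₂)))
      where open Instance l m z

    s-distrib : ∀ l m → s (l ⊔ m) ≃ s l ⊔ s m
    s-distrib l m = subst₂ _≃_
      (cong s (cong₂ _⊔_ σ₁ σ₂)) (cong₂ _⊔_ (cong s σ₁) (cong s σ₂))
      ([]-cong σ (axiom (s-⊔ i₁ i₂)))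
      where open Instance l m z

    ⊔-absorb : ∀ l → l ⊔ s l ≃ s l
    ⊔-absorb l = []-cong (λ _ → l) (axiom (absorb i₁))

    ⊔-idem : ∀ l → l ⊔ l ≃ l
    ⊔-idem l = []-cong (λ _ → l) (axiom (idem i₁))

    ⊔-swap : ∀ l m n → l ⊔ (m ⊔ n) ≃ m ⊔ (l ⊔ n)
    ⊔-swap l m n = begin
      l ⊔ (m ⊔ n)   ≈⟨ ⊔-assoc l m n ⟩
      (l ⊔ m) ⊔ n   ≈⟨ ⊔-cong (⊔-comm l m) ≃-refl ⟩
      (m ⊔ l) ⊔ n   ≈⟨ ⊔-assoc m l n ⟨
      m ⊔ (l ⊔ n)   ∎

    absorb-s : ∀ {l m} → l ⊔ m ≃ m → l ⊔ s m ≃ s m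
    absorb-s {l} {m} e = begin
      l ⊔ s m           ≈⟨ ⊔-cong ≃-refl (s-cong e) ⟨
      l ⊔ s (l ⊔ m)     ≈⟨ ⊔-cong ≃-refl (s-distrib l m) ⟩
      l ⊔ (s l ⊔ s m)   ≈⟨ ⊔-assoc l (s l) (s m) ⟩
      (l ⊔ s l) ⊔ s m   ≈⟨ ⊔-cong (⊔-absorb l) ≃-refl ⟩
      s l ⊔ s m         ≈⟨ s-distrib l m ⟨
      s (l ⊔ m)         ≈⟨ s-cong e ⟩
      s m               ∎

    absorb-s^ : ∀ n l → l ⊔ (s^ n) l ≃ (s^ n) l
    absorb-s^ zero    l = ⊔-idem l
    absorb-s^ (suc n) l = absorb-s (absorb-s^ n l)

    s^-⊔ : ∀ m n l → (s^ m) l ⊔ (s^ n) l ≃ (s^ (m ℕ.⊔ n)) l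
    s^-⊔ zero    n       l = absorb-s^ n l
    s^-⊔ (suc m) zero    l = ≃-trans (⊔-comm _ l) (absorb-s^ (suc m) l)
    s^-⊔ (suc m) (suc n) l = ≃-trans (≃-sym (s-distrib _ _)) (s-cong (s^-⊔ m n l))

    flat : ℕ → Summands → Level
    flat k []             = (s^ k) z
    flat k ((i , n) ∷ us) = (s^ n) (var i) ⊔ flat k us

    flat-⨆⁺ : ∀ k u us → (s^ k) z ⊔ ⨆⁺ u us ≃ flat k (u ∷ us)
    flat-⨆⁺ k u []       = ⊔-comm _ _
    flat-⨆⁺ k u (v ∷ us) =
      ≃-trans (⊔-swap _ _ _) (⊔-cong ≃-refl (flat-⨆⁺ k v us))

    nf-flat : ∀ k us → nf k us ≃ flat k us
    nf-flat k []       = ≃-refl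
    nf-flat k (u ∷ us) = flat-⨆⁺ k u us

    flat-sucAll : ∀ k us → flat (suc k) (sucAll us) ≃ s (flat k us)
    flat-sucAll k []       = ≃-refl
    flat-sucAll k (u ∷ us) =
      ≃-trans (⊔-cong ≃-refl (flat-sucAll k us)) (≃-sym (s-distrib _ _))

    flat-insert : ∀ k i n us → flat k (insert (i , n) us) ≃ (s^ n) (var i) ⊔ flat k us
    flat-insert k i n []             = ≃-refl
    flat-insert k i n ((j , m) ∷ us) with compare i j
    ... | tri< _ _ _    = ≃-refl
    ... | tri≈ _ refl _ =
      ≃-trans (⊔-cong (≃-sym (s^-⊔ n m (var i))) ≃-refl) (≃-sym (⊔-assoc _ _ _))
    ... | tri> _ _ _    =
      ≃-trans (⊔-cong ≃-refl (flat-insert k i n us)) (⊔-swap _ _ _)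

    flat-max : ∀ k k′ us → flat (k ℕ.⊔ k′) us ≃ (s^ k) z ⊔ flat k′ us
    flat-max k k′ []       = ≃-sym (s^-⊔ k k′ z)
    flat-max k k′ (u ∷ us) = ≃-trans (⊔-cong ≃-refl (flat-max k k′ us)) (⊔-swap _ _ _)

    flat-merge : ∀ k k′ us vs → flat (k ℕ.⊔ k′) (foldr insert vs us) ≃ flat k us ⊔ flat k′ vs
    flat-merge k k′ []             vs = flat-max k k′ vs
    flat-merge k k′ ((i , n) ∷ us) vs =
      ≃-trans (flat-insert _ i n (foldr insert vs us))
        (≃-trans (⊔-cong ≃-refl (flat-merge k k′ us vs)) (⊔-assoc _ _ _))

    flat-normalise : ∀ l → flat (proj₁ (normalise l)) (proj₂ (normalise l)) ≃ l
    flat-normalise (var i) = axiom (unit i)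
    flat-normalise z       = ≃-refl
    flat-normalise (s l)   =
      ≃-trans (flat-sucAll _ (proj₂ (normalise l))) (s-cong (flat-normalise l))
    flat-normalise (l ⊔ m) =
      ≃-trans (flat-merge _ _ (proj₂ (normalise l)) _)
        (⊔-cong (flat-normalise l) (flat-normalise m))

  ^-≃ : ∀ l → l ^ ≃ l
  ^-≃ l = ≃-trans (nf-flat _ (proj₂ (normalise l))) (flat-normalise l)

{-# OPTIONS --safe #-}
-- A level denotes the natural number obtained by reading s as successor and ⊔
-- as maximum under a valuation of the variables, and ≃ is sound for this
-- reading.  A substitution solving C therefore yields a single valuation
-- solving C.  Each step preserves the existence of a solving valuation: in
-- (Eliminate 2) the fresh i′ receives the value of i, and putting a constraint
-- in normal form only drops summands that are strictly below the common value
-- of both sides.  The constraint of (Clash) equates 0 with a positive number.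
module Submission where

open import Defs
open import Data.Empty.Polymorphic using (⊥-elim) renaming (⊥ to Empty)
open import Data.List.Base using (List; []; _∷_; _++_; map; foldr)
open import Data.List.Membership.Propositional using (_∈_; _∉_; find)
open import Data.List.Membership.Propositional.Properties
  using (∈-++⁺ˡ; ∈-++⁺ʳ; ∈-filter⁺; ∈-map⁺; ∈-map⁻; foldr-selective)
open import Data.List.Properties
  using (foldr-preservesᵒ; foldr-forcesᵇ; foldr-fusion; foldr-map; map-∘; map-cong-local)
open import Data.List.Relation.Binary.BagAndSetEquality using (_∼[_]_; set)
open import Data.List.Relation.Binary.Subset.Propositional using (_⊆_)
open import Data.List.Relation.Binary.Subset.Propositional.Properties using (filter-⊆; map⁺)
open import Data.List.Relation.Unary.All as All using (All; []; _∷_)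
import Data.List.Relation.Unary.All.Properties as All
open import Data.List.Relation.Unary.Any using (Any; here)
open import Data.Nat.Base as ℕ using (ℕ; zero; suc; _+_; _∸_; _⊓_; _≤_)
import Data.Nat.Properties as ℕ
open import Data.Product.Base using (_×_; _,_; ∃; proj₁; proj₂; uncurry)
open import Data.Sum.Base using (_⊎_; inj₁; inj₂)
open import Function.Base using (const; _∘_)
open import Function.Bundles using (Equivalence)
open import Relation.Binary.Construct.Closure.ReflexiveTransitive using (ε; _◅_)
open import Relation.Binary.PropositionalEquality
  using (_≡_; _≢_; refl; sym; trans; cong; cong₂; subst; subst₂; module ≡-Reasoning)
open import Relation.Binary.Structures using (IsStrictTotalOrder)
open import Relation.Nullary.Decidable using (yes; no)
open import Relation.Nullary.Negation using (¬_; contradiction)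

-- Maxima and minima of lists of natural numbers.

maximum : ℕ → List ℕ → ℕ
maximum = foldr ℕ._⊔_

base≤maximum : ∀ k ns → k ≤ maximum k ns
base≤maximum k ns = foldr-preservesᵒ {P = k ≤_}
  (λ { m n (inj₁ k≤m) → ℕ.m≤n⇒m≤n⊔o n k≤m ; m n (inj₂ k≤n) → ℕ.m≤n⇒m≤o⊔n m k≤n })
  k ns (inj₁ ℕ.≤-refl)

∈⇒≤maximum : ∀ k {ns n} → n ∈ ns → n ≤ maximum k ns
∈⇒≤maximum k {ns} = All.lookup (foldr-forcesᵇ {P = _≤ maximum k ns}
  (λ m n p → ℕ.m⊔n≤o⇒m≤o m n p , ℕ.m⊔n≤o⇒n≤o m n p) k ns ℕ.≤-refl)

-- A maximum is attained, either by the base or by an element, and both also occur on the larger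
-- side.
maximum-mono-⊆ : ∀ k {ms ns} → ms ⊆ ns → maximum k ms ≤ maximum k ns
maximum-mono-⊆ k {ms} {ns} ms⊆ns with foldr-selective ℕ.⊔-sel k ms
... | inj₁ eq = subst (_≤ maximum k ns) (sym eq) (base≤maximum k ns)
... | inj₂ m∈ = ∈⇒≤maximum k (ms⊆ns m∈)

-- Truncated subtraction distributes over binary maximum, so it fuses with the fold.
maximum-∸ : ∀ o k ns → maximum (k ∸ o) (map (_∸ o) ns) ≡ maximum k ns ∸ o
maximum-∸ o k ns = trans (foldr-map ℕ._⊔_ (_∸ o) (k ∸ o) ns)
  (sym (foldr-fusion (_∸ o) k (ℕ.∸-distribʳ-⊔ o) ns))

minimum≤ : ∀ k ns → All (foldr _⊓_ k ns ≤_) ns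
minimum≤ k ns = foldr-forcesᵇ {P = foldr _⊓_ k ns ≤_}
  (λ m n p → ℕ.m≤n⊓o⇒m≤n m n p , ℕ.m≤n⊓o⇒m≤o m n p) k ns ℕ.≤-refl

module Semantics {a ℓ p} (𝓘 : LevelVariables a ℓ p) where

  open Unification 𝓘
  open IsStrictTotalOrder isStrictTotalOrder using (_≟_)

  -- Evaluation of levels and soundness of `≃`.

  Valuation : Set a
  Valuation = Var → ℕ

  ⟦_⟧ : Level → Valuation → ℕ
  ⟦ var i ⟧ v = v i
  ⟦ z ⟧     v = 0
  ⟦ s l ⟧   v = suc (⟦ l ⟧ v)
  ⟦ l ⊔ m ⟧ v = ⟦ l ⟧ v ℕ.⊔ ⟦ m ⟧ v

  Solves : Valuation → Constraint → Set
  Solves v (l ≐ m) = ⟦ l ⟧ v ≡ ⟦ m ⟧ v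

  ⟦[]⟧ : ∀ l θ v → ⟦ l [ θ ] ⟧ v ≡ ⟦ l ⟧ (λ i → ⟦ θ i ⟧ v)
  ⟦[]⟧ (var i) θ v = refl
  ⟦[]⟧ z       θ v = refl
  ⟦[]⟧ (s l)   θ v = cong suc (⟦[]⟧ l θ v)
  ⟦[]⟧ (l ⊔ m) θ v = cong₂ ℕ._⊔_ (⟦[]⟧ l θ v) (⟦[]⟧ m θ v)

  ⟦⟧-cong : ∀ l {v w} → (∀ {i} → i ∈ vars l → v i ≡ w i) → ⟦ l ⟧ v ≡ ⟦ l ⟧ w
  ⟦⟧-cong (var i) eq = eq (here refl)
  ⟦⟧-cong z       eq = refl
  ⟦⟧-cong (s l)   eq = cong suc (⟦⟧-cong l eq)
  ⟦⟧-cong (l ⊔ m) eq =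
    cong₂ ℕ._⊔_ (⟦⟧-cong l (eq ∘ ∈-++⁺ˡ)) (⟦⟧-cong m (eq ∘ ∈-++⁺ʳ (vars l)))

  ≈-sound : ∀ {l m} → l ≈ m → ∀ v → ⟦ l ⟧ v ≡ ⟦ m ⟧ v
  ≈-sound (assoc i j k) v = sym (ℕ.⊔-assoc (v i) (v j) (v k))
  ≈-sound (comm i j)    v = ℕ.⊔-comm (v i) (v j)
  ≈-sound (s-⊔ i j)     v = refl
  ≈-sound (absorb i)    v = ℕ.m≤n⇒m⊔n≡n (ℕ.n≤1+n (v i))
  ≈-sound (unit i)      v = ℕ.⊔-identityʳ (v i)
  ≈-sound (idem i)      v = ℕ.⊔-idem (v i)

  ≃-sound : ∀ {l m} → l ≃ m → ∀ v → ⟦ l ⟧ v ≡ ⟦ m ⟧ v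
  ≃-sound (axiom e)         v = ≈-sound e v
  ≃-sound ≃-refl            v = refl
  ≃-sound (≃-sym e)         v = sym (≃-sound e v)
  ≃-sound (≃-trans e f)     v = trans (≃-sound e v) (≃-sound f v)
  ≃-sound (s-cong e)        v = cong suc (≃-sound e v)
  ≃-sound (⊔-cong e f)      v = cong₂ ℕ._⊔_ (≃-sound e v) (≃-sound f v)
  -- The induction hypothesis is used at the valuation `λ i → ⟦ θ i ⟧ v`, which is why `v` is
  -- quantified inside the induction.
  ≃-sound ([]-cong {l} {m} θ e) v =
    trans (⟦[]⟧ l θ v) (trans (≃-sound e _) (sym (⟦[]⟧ m θ v)))

  ⟦s^⟧ : ∀ n l v → ⟦ (s^ n) l ⟧ v ≡ n + ⟦ l ⟧ v
  ⟦s^⟧ zero    l v = refl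
  ⟦s^⟧ (suc n) l v = cong suc (⟦s^⟧ n l v)

  ∋⇒≤ : ∀ {l t} → l ∋ t → ∀ v → ⟦ t ⟧ v ≤ ⟦ l ⟧ v
  ∋⇒≤ here              v = ℕ.≤-refl
  ∋⇒≤ (left {m = m} l∋) v = ℕ.m≤n⇒m≤n⊔o (⟦ m ⟧ v) (∋⇒≤ l∋ v)
  ∋⇒≤ (right {l = l} m∋) v = ℕ.m≤n⇒m≤o⊔n (⟦ l ⟧ v) (∋⇒≤ m∋ v)

  -- Values of summand lists and normalisation of constraints.

  weight : Valuation → Var × ℕ → ℕ
  weight v (i , n) = n + v i

  -- The exponent of `z` is the base of the maximum, so one formula covers both clauses of `nf`.
  join : Valuation → ℕ → Summands → ℕ
  join v k us = maximum k (map (weight v) us)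

  ⟦⨆⁺⟧ : ∀ v k u us → k ℕ.⊔ ⟦ ⨆⁺ u us ⟧ v ≡ join v k (u ∷ us)
  ⟦⨆⁺⟧ v k (i , n) [] =
    trans (cong (k ℕ.⊔_) (⟦s^⟧ n (var i) v)) (ℕ.⊔-comm k (n + v i))
  ⟦⨆⁺⟧ v k (i , n) (u ∷ us) = begin
    k ℕ.⊔ (⟦ (s^ n) (var i) ⟧ v ℕ.⊔ r)  ≡⟨ cong (λ x → k ℕ.⊔ (x ℕ.⊔ r)) (⟦s^⟧ n (var i) v) ⟩
    k ℕ.⊔ ((n + v i) ℕ.⊔ r)             ≡⟨ ℕ.⊔-assoc k (n + v i) r ⟨
    (k ℕ.⊔ (n + v i)) ℕ.⊔ r             ≡⟨ cong (ℕ._⊔ r) (ℕ.⊔-comm k (n + v i)) ⟩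
    ((n + v i) ℕ.⊔ k) ℕ.⊔ r             ≡⟨ ℕ.⊔-assoc (n + v i) k r ⟩
    (n + v i) ℕ.⊔ (k ℕ.⊔ r)             ≡⟨ cong ((n + v i) ℕ.⊔_) (⟦⨆⁺⟧ v k u us) ⟩
    join v k ((i , n) ∷ u ∷ us)         ∎
    where
    open ≡-Reasoning
    r = ⟦ ⨆⁺ u us ⟧ v

  ⟦nf⟧ : ∀ v k us → ⟦ nf k us ⟧ v ≡ join v k us
  ⟦nf⟧ v k []       = trans (⟦s^⟧ k z v) (ℕ.+-identityʳ k)
  ⟦nf⟧ v k (u ∷ us) = trans
    (cong (ℕ._⊔ ⟦ ⨆⁺ u us ⟧ v) (⟦nf⟧ v k [])) (⟦⨆⁺⟧ v k u us)

  -- Soundness applied to `^-≃` gives this without an induction through `insert`.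
  join-normalise : ∀ v l → let (k , us) = normalise l in join v k us ≡ ⟦ l ⟧ v
  join-normalise v l = trans (sym (uncurry (⟦nf⟧ v) (normalise l))) (≃-sound (^-≃ l) v)

  -- A dropped summand has a strictly larger counterpart in others, so it does
  -- not attain the common value.
  join-dropSmaller : ∀ v k us k′ others → join v k us ≡ join v k′ others →
                     join v k (dropSmaller us others) ≡ join v k us
  join-dropSmaller v k us k′ others eq = ℕ.≤-antisym
    (maximum-mono-⊆ k (map⁺ (weight v) (filter-⊆ _ us))) attained
    where
    kept = map (weight v) (dropSmaller us others)

    attained : join v k us ≤ maximum k kept
    attained with foldr-selective ℕ.⊔-sel k (map (weight v) us)
    ... | inj₁ is-base = subst (_≤ maximum k kept) (sym is-base) (base≤maximum k kept)
    ... | inj₂ ∈weights with ∈-map⁻ (weight v) ∈weights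
    ...   | (i , n) , u∈ , is-weight = subst (_≤ maximum k kept) (sym is-weight)
      (∈⇒≤maximum k (∈-map⁺ (weight v) (∈-filter⁺ _ u∈ not-dropped)))
      where
      not-dropped : ¬ Any (λ (j , m) → i ≡ j × n ℕ.< m) others
      not-dropped any with find any
      ... | _ , o∈ , refl , n<m = ℕ.<-irrefl (trans (sym is-weight) eq)
        (ℕ.<-≤-trans (ℕ.+-monoˡ-< (v i) n<m)
                     (∈⇒≤maximum k′ (∈-map⁺ (weight v) o∈)))

  -- Since `o ≤ n`, the truncated `(n ∸ o) + v i` equals `(n + v i) ∸ o`; the subtraction then moves
  -- out of the maximum.
  join-lower : ∀ v o k us → All ((o ≤_) ∘ proj₂) us →
               join v (k ∸ o) (map (λ (i , n) → i , n ∸ o) us) ≡ join v k us ∸ o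
  join-lower v o k us o≤ = begin
    maximum (k ∸ o) (map (weight v) (map _ us))
      ≡⟨ cong (maximum (k ∸ o)) (map-∘ us) ⟨
    maximum (k ∸ o) (map (λ (i , n) → (n ∸ o) + v i) us)
      ≡⟨ cong (maximum (k ∸ o)) (map-cong-local (All.map (sym ∘ ℕ.+-∸-comm _) o≤)) ⟩
    maximum (k ∸ o) (map (λ u → weight v u ∸ o) us)
      ≡⟨ cong (maximum (k ∸ o)) (map-∘ us) ⟩
    maximum (k ∸ o) (map (_∸ o) (map (weight v) us))
      ≡⟨ maximum-∸ o k (map (weight v) us) ⟩
    join v k us ∸ o ∎
    where open ≡-Reasoning

  -- The sides have a common value, so dropping summands changes neither; lowering then subtracts
  -- the same `least` from both.
  ^ᶜ-sound : ∀ v c → Solves v c → Solves v (c ^ᶜ)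
  ^ᶜ-sound v (l₁ ≐ l₂) eq =
    trans (side k₁ vs₁ (All.++⁻ˡ vs₁ le))
      (trans (cong (_∸ least) eqᵈ) (sym (side k₂ vs₂ (All.++⁻ʳ vs₁ le))))
    where
    k₁ = proj₁ (normalise l₁)
    k₂ = proj₁ (normalise l₂)
    us₁ = proj₂ (normalise l₁)
    us₂ = proj₂ (normalise l₂)
    vs₁ = dropSmaller us₁ us₂
    vs₂ = dropSmaller us₂ us₁
    least = foldr _⊓_ (k₁ ⊓ k₂) (map proj₂ (vs₁ ++ vs₂))

    lower : Summands → Summands
    lower = map λ (i , n) → i , n ∸ least

    eqʲ : join v k₁ us₁ ≡ join v k₂ us₂
    eqʲ = trans (join-normalise v l₁) (trans eq (sym (join-normalise v l₂)))

    eqᵈ : join v k₁ vs₁ ≡ join v k₂ vs₂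
    eqᵈ = trans (join-dropSmaller v k₁ us₁ k₂ us₂ eqʲ)
      (trans eqʲ (sym (join-dropSmaller v k₂ us₂ k₁ us₁ (sym eqʲ))))

    le : All ((least ≤_) ∘ proj₂) (vs₁ ++ vs₂)
    le = All.map⁻ (minimum≤ (k₁ ⊓ k₂) (map proj₂ (vs₁ ++ vs₂)))

    side : ∀ k us → All ((least ≤_) ∘ proj₂) us →
           ⟦ nf (k ∸ least) (lower us) ⟧ v ≡ join v k us ∸ least
    side k us least≤ = trans (⟦nf⟧ v (k ∸ least) (lower us)) (join-lower v least k us least≤)

  -- Substitution and change of valuation.

  -- Two valuations are kept apart because (Eliminate 2) gives its fresh variable a new value: `v`
  -- evaluates the original level, `w` the instance.
  ⟦[/]⟧ : ∀ l m i v w → ⟦ m ⟧ w ≡ v i → (∀ {j} → j ∈ vars l → j ≢ i → w j ≡ v j) →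
          ⟦ l [ m / i ] ⟧ w ≡ ⟦ l ⟧ v
  ⟦[/]⟧ l m i v w eq agree = trans (⟦[]⟧ l (m / i) w) (⟦⟧-cong l at)
    where
    at : ∀ {j} → j ∈ vars l → ⟦ (m / i) j ⟧ w ≡ v j
    at {j} j∈ with j ≟ i
    ... | yes refl = eq
    ... | no j≢i   = agree j∈ j≢i

  eliminate-sound : ∀ C m i v w → ⟦ m ⟧ w ≡ v i →
                    (∀ {j} → j ∈ varsᶜˢ C → j ≢ i → w j ≡ v j) →
                    All (Solves v) C → All (Solves w) (C [ m / i ]^ᶜˢ)
  eliminate-sound []            m i v w eq agree []          = []
  eliminate-sound ((l₁ ≐ l₂) ∷ C) m i v w eq agree (sol ∷ sols) =
    ^ᶜ-sound w ((l₁ ≐ l₂) [ m / i ]ᶜ) (trans (⟦[/]⟧ l₁ m i v w eq (agree ∘ ∈-++⁺ˡ ∘ ∈-++⁺ˡ))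
      (trans sol (sym (⟦[/]⟧ l₂ m i v w eq (agree ∘ ∈-++⁺ˡ ∘ ∈-++⁺ʳ (vars l₁))))))
    ∷ eliminate-sound C m i v w eq (agree ∘ ∈-++⁺ʳ (varsᶜ (l₁ ≐ l₂))) sols

  module _ (v : Valuation) (i : Var) (n : ℕ) where

    update : Valuation
    update j with j ≟ i
    ... | yes _ = n
    ... | no _  = v j

    update-hit : update i ≡ n
    update-hit with i ≟ i
    ... | yes _  = refl
    ... | no i≢i = contradiction refl i≢i

    update-miss : ∀ {j} → j ≢ i → update j ≡ v j
    update-miss {j} j≢i with j ≟ i
    ... | yes j≡i = contradiction j≡i j≢i
    ... | no _    = refl

  -- Soundness of the unification steps.

  All-resp-set : ∀ {q} {P : Constraint → Set q} {C D} → D ∼[ set ] C → All P D → All P C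
  All-resp-set D∼C ps = All.tabulate (All.lookup ps ∘ Equivalence.from D∼C)

  Solvable : State → Set a
  Solvable (C ∥ θ) = ∃ λ v → All (Solves v) C
  Solvable ⊥       = Empty

  ⇝-sound : ∀ {S T} → S ⇝ T → Solvable S → Solvable T
  ⇝-sound (trivial l D∼) (v , sols) = v , All.tail (All-resp-set D∼ sols)
  ⇝-sound (orient l l′ D∼ _) (v , sols) with All-resp-set D∼ sols
  ... | sol ∷ sols′ = v , sym sol ∷ sols′
  ⇝-sound (eliminate₁ {C = C} i l D∼ i∉l) (v , sols) with All-resp-set D∼ sols
  -- The value of `z ⊔ var i` computes to `v i`, so `sym sol` says that `l` has the value of `i`.
  ... | sol ∷ sols′ = v , eliminate-sound C l i v v (sym sol) (λ _ _ → refl) sols′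
  ⇝-sound (eliminate₂ {C = C} i l i′ D∼ _ _ _ i′∉l i′∉C _) (v , sols)
    with All-resp-set D∼ sols
  ... | sol ∷ sols′ = w , eliminate-sound C (l [ var i′ / i ]) i v w l′≡i (agree i′∉C) sols′
    where
    w = update v i′ (v i)

    agree : ∀ {is j} → i′ ∉ is → j ∈ is → j ≢ i → w j ≡ v j
    agree i′∉ j∈ _ = update-miss v i′ (v i) λ { refl → i′∉ j∈ }

    l′≡i : ⟦ l [ var i′ / i ] ⟧ w ≡ v i
    -- Renaming `i` to `i′` preserves the value of `l`, which is `v i` by `sol`.
    l′≡i = trans (⟦[/]⟧ l (var i′) i v w (update-hit v i′ (v i)) (agree i′∉l)) (sym sol)
  ⇝-sound (decompose V _ D∼) (v , sols) with All-resp-set D∼ sols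
  ... | sol ∷ sols′ = v , All.++⁺ (All.map⁺ (All.tabulate zero-at)) sols′
    where
    zero-at : ∀ {i} → i ∈ V → v i ≡ 0
    -- The value `v i` is one of the weights whose maximum is 0.
    zero-at i∈ = ℕ.n≤0⇒n≡0 (subst (_ ≤_) (sym (trans sol (⟦nf⟧ v 0 (map (_, 0) V))))
      (∈⇒≤maximum 0 (∈-map⁺ (weight v) (∈-map⁺ (_, 0) i∈))))
  ⇝-sound (clash l n D∼ n≢0 summand) (v , sols) with All-resp-set D∼ sols
  ... | sol ∷ _ = contradiction (ℕ.n≤0⇒n≡0 (n≤0 summand)) n≢0
    where
    s^-summand : ∀ t → l ∋ (s^ n) t → n ≤ 0
    -- The summand has value `n + ⟦ t ⟧ v`, bounded by the value 0 of `l`.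
    s^-summand t l∋ = ℕ.≤-trans (ℕ.m≤m+n n (⟦ t ⟧ v))
      (subst₂ _≤_ (⟦s^⟧ n t v) (sym sol) (∋⇒≤ l∋ v))

    n≤0 : (∃ λ i → l ∋ (s^ n) (var i)) ⊎ l ∋ (s^ n) z → n ≤ 0
    n≤0 (inj₁ (i , l∋)) = s^-summand (var i) l∋
    n≤0 (inj₂ l∋)       = s^-summand z l∋

  ⇝*-sound : ∀ {S T} → S ⇝* T → Solvable S → Solvable T
  ⇝*-sound ε        sol = sol
  ⇝*-sound (r ◅ rs) sol = ⇝*-sound rs (⇝-sound r sol)

  ⊨⇒Solves : ∀ {θ C} v → θ ⊨ C → All (Solves (λ i → ⟦ θ i ⟧ v)) C
  ⊨⇒Solves {θ} v = All.map λ {(l ≐ m)} e →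
    trans (sym (⟦[]⟧ l θ v)) (trans (≃-sound e v) (⟦[]⟧ m θ v))

mainTheorem10 : ∀ {a ℓ p} (𝓘 : LevelVariables a ℓ p) →
    let open Unification 𝓘 in
    (C : List Constraint) →
    All IsNormalᶜ C →
    (∀ i → i ∈ varsᶜˢ C → ¬ Fresh i) →
    (C ∥ id) ⇝* ⊥ →
    ¬ (∃ λ (θ : Subst) → θ ⊨ C)
mainTheorem10 𝓘 C _ _ steps (θ , θ⊨C) =
  -- Evaluating `θ` at any valuation gives a solution; the zero valuation is a concrete choice.
  ⊥-elim (⇝*-sound steps (_ , ⊨⇒Solves (const 0) θ⊨C))
  where open Semantics 𝓘
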